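{- Let $n\ge 3$ and let $m$ be an integer with $2\leq m\leq \lceil \frac{n}{2}\rceil$. Let $P_n$ be the path with $n$ edges. Then $$rb(P_n,mK_2)=\begin{cases} 2m-1, & n\leq 3m-3,\\ 2m-2, & n>3m-3.\end{cases}$$
   Context: All graphs are simple and finite. $P_n$ denotes the path with $n$ edges (and $n+1$ vertices). $mK_2$ denotes a matching of size $m$ (that is, $m$ pairwise disjoint edges). An edge-coloring of a graph $G$ with $r$ colors is an arbitrary (not necessarily proper) assignment of colors to the edges of $G$ in which exactly $r$ distinct colors appear. A subgraph of an edge-colored graph is rainbow if no two of its edges have the same color. For a graph $G$ and a subgraph $H$ of $G$, the rainbow number $rb(G,H)$ is the minimum positive integer $r$ such that every edge-coloring of $G$ with $r$ colors contains a rainbow subgraph isomorphic to $H$. -}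

module Defs where

open import Data.Bool using (Bool; true; false; T; _∧_; _∨_; _xor_)
open import Data.Bool.Properties using (T-∧; T-∨; ∨-comm)
open import Data.Fin using (Fin; toℕ)
open import Data.Fin.Properties as Fin using ()
open import Data.Nat using (ℕ; suc; _≤_; _≡ᵇ_)
open import Data.Nat.Properties using (≡ᵇ⇒≡; 1+n≢n)
open import Data.Product using (Σ-syntax; _×_; _,_; proj₁; proj₂)
open import Data.Sum using (_⊎_; [_,_]′)
open import Function using (_∘_; _⇔_; _↔_; Equivalence; Inverse; StrictlySurjective)
open import Relation.Binary.Definitions using (Symmetric)
open import Relation.Binary.PropositionalEquality using (_≡_; sym; subst)
open import Relation.Nullary using (¬_)
open import Relation.Nullary.Decidable using (⌊_⌋; toWitness; fromWitness)

-- Adjacency is Boolean-valued so that "u v is an edge" is a decidable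
-- proposition.  Finiteness is carried by the vertex type V.
record SimpleGraph (V : Set) : Set where
  field
    adj : V → V → Bool

  Adj : V → V → Set
  Adj u v = T (adj u v)

  field
    symmetric   : Symmetric Adj
    irreflexive : ∀ v → ¬ Adj v v

open SimpleGraph public using (adj; Adj)

-- An edge {u , v} is represented by either of the pairs (u , v), (v , u);
-- these are identified by _∼_ below.
Edge : ∀ {V} → SimpleGraph V → Set
Edge {V} G = Σ[ u ∈ V ] Σ[ v ∈ V ] Adj G u v

_∼_ : ∀ {V} {G : SimpleGraph V} → Edge G → Edge G → Set
(u , v , _) ∼ (x , y , _) = (u ≡ x × v ≡ y) ⊎ (u ≡ y × v ≡ x)

-- Surjectivity expresses that exactly r distinct colors appear.
record EdgeColoring {V : Set} (G : SimpleGraph V) (r : ℕ) : Set where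
  field
    color      : Edge G → Fin r
    respects-∼ : ∀ e f → _∼_ {G = G} e f → color e ≡ color f
    surjective : StrictlySurjective _≡_ color

open EdgeColoring public using (color)

record Subgraph {V : Set} (G : SimpleGraph V) : Set where
  field
    vert      : V → Bool
    edge      : V → V → Bool
    edge-sym  : ∀ u v → T (edge u v) → T (edge v u)
    edge⇒adj  : ∀ u v → T (edge u v) → Adj G u v
    edge⇒vert : ∀ u v → T (edge u v) → T (vert u)

  Vertex : Set
  Vertex = Σ[ v ∈ V ] T (vert v)

  graph : SimpleGraph Vertex
  graph = record
    { adj         = λ u v → edge (proj₁ u) (proj₁ v)
    ; symmetric   = λ {u} {v} → edge-sym (proj₁ u) (proj₁ v)
    ; irreflexive = λ v e →
        SimpleGraph.irreflexive G (proj₁ v) (edge⇒adj (proj₁ v) (proj₁ v) e)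
    }

  inclusion : Edge graph → Edge G
  inclusion ((u , _) , (v , _) , e) = u , v , edge⇒adj u v e

record _≅_ {V W : Set} (G : SimpleGraph V) (H : SimpleGraph W) : Set where
  field
    bijection : V ↔ W
    adj⇔      : ∀ u v → Adj G u v ⇔ Adj H (Inverse.to bijection u) (Inverse.to bijection v)

Rainbow : ∀ {V} {G : SimpleGraph V} {r} → EdgeColoring G r → Subgraph G → Set
Rainbow {G = G} c S = ∀ (e f : Edge graph) →
  color c (inclusion e) ≡ color c (inclusion f) →
  _∼_ {G = G} (inclusion e) (inclusion f)
  where open Subgraph S

ForcesRainbow : ∀ {V W} → SimpleGraph V → SimpleGraph W → ℕ → Set
ForcesRainbow G H r = ∀ (c : EdgeColoring G r) →
  Σ[ S ∈ Subgraph G ] (Subgraph.graph S ≅ H × Rainbow c S)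

-- "rb(G,H) = r", as a relation.  When r exceeds the number of edges of G there
-- is no coloring with exactly r colors, and ForcesRainbow G H r holds vacuously.
record IsRainbowNumber {V W : Set} (G : SimpleGraph V) (H : SimpleGraph W) (r : ℕ) : Set where
  field
    positive : 1 ≤ r
    forces   : ForcesRainbow G H r
    minimal  : ∀ s → 1 ≤ s → ForcesRainbow G H s → r ≤ s

-- The index counts edges, not vertices.
P : (n : ℕ) → SimpleGraph (Fin (suc n))
P n = record { adj = adjP ; symmetric = λ {i} {j} → symP i j ; irreflexive = irrP }
  where
  adjP : Fin (suc n) → Fin (suc n) → Bool
  adjP i j = (suc (toℕ i) ≡ᵇ toℕ j) ∨ (suc (toℕ j) ≡ᵇ toℕ i)

  symP : ∀ i j → T (adjP i j) → T (adjP j i)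
  symP i j = subst T (∨-comm (suc (toℕ i) ≡ᵇ toℕ j) (suc (toℕ j) ≡ᵇ toℕ i))

  irrP : ∀ i → ¬ T (adjP i i)
  irrP i t = [ loop , loop ]′ (Equivalence.to (T-∨ {suc (toℕ i) ≡ᵇ toℕ i}) t)
    where
    loop : ¬ T (suc (toℕ i) ≡ᵇ toℕ i)
    loop = 1+n≢n ∘ ≡ᵇ⇒≡ (suc (toℕ i)) (toℕ i)

-- The i-th edge of the matching joins (i , false) and (i , true).
_K₂ : (m : ℕ) → SimpleGraph (Fin m × Bool)
m K₂ = record { adj = adjM ; symmetric = λ {u} {v} → symM u v ; irreflexive = irrM }
  where
  adjM : Fin m × Bool → Fin m × Bool → Bool
  adjM (i , a) (j , b) = ⌊ i Fin.≟ j ⌋ ∧ (a xor b)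

  xor-sym : ∀ a b → T (a xor b) → T (b xor a)
  xor-sym false true  t = t
  xor-sym true  false t = t

  xor-irr : ∀ a → ¬ T (a xor a)
  xor-irr false ()
  xor-irr true  ()

  symM : ∀ u v → T (adjM u v) → T (adjM v u)
  symM (i , a) (j , b) t with Equivalence.to (T-∧ {⌊ i Fin.≟ j ⌋}) t
  ... | p , q = Equivalence.from T-∧
    (fromWitness {a? = j Fin.≟ i} (sym (toWitness {a? = i Fin.≟ j} p)) , xor-sym a b q)

  irrM : ∀ u → ¬ T (adjM u u)
  irrM (i , a) t = xor-irr a (proj₂ (Equivalence.to (T-∧ {⌊ i Fin.≟ i ⌋}) t))

{-# OPTIONS --safe #-}
module Submission where

-- Upper bounds.  Scanning the path from left to right, taking every edge of a
-- new colour and dropping its successor gains one matching edge per two new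
-- colours, so 2m − 1 colours suffice.  With only 2m − 2 colours it is enough to
-- save one colour somewhere.  As long as nothing is saved, the path splits into
-- runs a₁ b₁ … aⱼ bⱼ of new colours separated by single edges of repeated
-- colours.  Any colour c met so far can be avoided: if c = bᵢ keep all the aᵢ,
-- if c = aᵢ switch from the a's to the b's at i for the rest of its run, which
-- uses the last edge of that run.  So a repeated colour c saves a colour unless
-- it stands directly after the run containing c as some aᵢ; hence each repeated
-- edge is charged to a run of length at least two, and the path has at most
-- 3(m − 1) edges.
--
-- Lower bounds.  Cut the path into m − 1 blocks coloured a b or a b a, or into
-- m − 2 blocks a b and one monochromatic block: two edges of one block either
-- meet or have the same colour.  Merging colours preserves this.

open import Defs
open import Data.Bool using (Bool; true; false; not; T; _xor_)
open import Data.Bool.Properties using (T-∧; T-∨; T-irrelevant; not-involutive)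
open import Data.Empty using (⊥-elim)
open import Data.Fin using (Fin; zero; suc; toℕ; inject₁; pinch)
open import Data.Fin.Properties as Fin
  using (any?; toℕ-injective; toℕ-inject₁; pigeonhole; <⇒≢; injective⇒≤; pinch-surjective)
open import Data.List using (List; []; _∷_; length; drop; map; allFin; lookup)
open import Data.List.Membership.DecPropositional using (_∈?_)
open import Data.List.Membership.Propositional using (_∈_)
open import Data.List.Membership.Propositional.Properties using (∈-allFin; ∈-map⁺; ∈-lookup)
open import Data.List.Membership.Setoid.Properties using (index-injective)
open import Data.List.Properties using (length-tabulate)
open import Data.List.Relation.Unary.All as All using (All; []; _∷_)
open import Data.List.Relation.Unary.All.Properties using (drop⁺)
open import Data.List.Relation.Unary.AllPairs as AllPairs using (AllPairs; []; _∷_)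
open import Data.List.Relation.Unary.AllPairs.Properties using (tabulate⁺-<)
open import Data.List.Relation.Unary.Any as Any using (here; there)
open import Data.Nat
  using (ℕ; zero; suc; _+_; _*_; _∸_; _≤_; _<_; _>_; _≡ᵇ_; _≤?_; _≤′_; ≤′-refl; ≤′-step;
         ⌊_/2⌋; ⌈_/2⌉; z≤n; s≤s; s≤s⁻¹)
open import Data.Nat.Properties
  using (≤-refl; ≤-reflexive; ≤-trans; ≤-antisym; ≤-<-trans; <-irrefl; <-cmp; ≰⇒>; ≮⇒≥; n≤1+n; n<1+n;
         +-suc; +-identityʳ; *-comm; *-monoʳ-≤; suc-injective; ≤⇒≤′; ≤′⇒≤; ≡ᵇ⇒≡; ≡⇒≡ᵇ)
open import Data.Product using (Σ-syntax; ∃; _×_; _,_; proj₁; proj₂)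
open import Data.Sum as Sum using (_⊎_; inj₁; inj₂; swap)
open import Function
  using (_∘_; id; case_of_; mk⇔; mk↔ₛ′; Equivalence; Inverse; StrictlySurjective)
open import Relation.Binary.Definitions using (DecidableEquality; Symmetric; tri<; tri≈; tri>)
open import Relation.Binary.PropositionalEquality
  using (_≡_; _≢_; refl; sym; trans; cong; cong₂; subst; subst₂; setoid)
open import Relation.Nullary using (¬_; Dec; yes; no)
open import Relation.Nullary.Decidable using (⌊_⌋; toWitness; fromWitness; map′; _⊎-dec_; _×-dec_)
open import Relation.Unary using (Pred; _⊆_)

-- Rainbow matchings as lists of edge positions

Apart : ∀ {n} → Fin n → Fin n → Set
Apart p q = suc (toℕ p) < toℕ q ⊎ suc (toℕ q) < toℕ p

module _ {n r : ℕ} (col : Fin n → Fin r) where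

  private
    _∈ᶜ?_ = _∈?_ (Fin._≟_ {r})

  RainbowPair : Fin n → Fin n → Set
  RainbowPair p q = Apart p q × col p ≢ col q

  RainbowMatching : ℕ → Set
  RainbowMatching m = Σ[ ps ∈ List (Fin n) ] (length ps ≡ m × AllPairs RainbowPair ps)

  newColors : List (Fin r) → List (Fin n) → ℕ
  newColors F []       = 0
  newColors F (p ∷ ps) with col p ∈ᶜ? F
  ... | yes _ = newColors F ps
  ... | no  _ = suc (newColors (col p ∷ F) ps)

  -- The scanning invariant: `apart` lets any edge still in `rest` join, and `Q` bounds the colours
  -- used, so an edge whose colour fails `Q` keeps the matching rainbow.
  record Matching (Q : Pred (Fin r) _) (rest : List (Fin n)) (l : ℕ) : Set where
    field
      positions : List (Fin n)
      size      : length positions ≡ l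
      rainbow   : AllPairs RainbowPair positions
      colors    : All (Q ∘ col) positions
      apart     : All (λ q → All (λ p → Apart p q) rest) positions

  open Matching

  Sorted : List (Fin n) → Set
  Sorted = AllPairs (λ p q → toℕ p < toℕ q)

  weaken : ∀ {Q Q′ ps l} → Q ⊆ Q′ → Matching Q ps l → Matching Q′ ps l
  weaken Q⊆Q′ M = record
    { positions = positions M ; size = size M ; rainbow = rainbow M
    ; colors = All.map Q⊆Q′ (colors M) ; apart = apart M }

  skip : ∀ {Q p ps l} → Matching Q (p ∷ ps) l → Matching Q ps l
  skip M = record
    { positions = positions M ; size = size M ; rainbow = rainbow M
    ; colors = colors M ; apart = All.map All.tail (apart M) }

  apart-after : ∀ {p} ps → Sorted (p ∷ ps) → All (λ q → Apart q p) (drop 1 ps)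
  apart-after []       _                        = []
  apart-after (q ∷ ps) ((p<q ∷ _) ∷ (q<ps ∷ _)) = All.map (inj₂ ∘ ≤-<-trans p<q) q<ps

  -- Only the edge right after `p` can meet it, so dropping the head of `ps` restores `apart`.
  add : ∀ {Q Q′ : Pred (Fin r) _} {p ps l} → Sorted (p ∷ ps) → Q ⊆ Q′ → Q′ (col p) → ¬ Q (col p) →
        Matching Q (p ∷ ps) l → Matching Q′ (drop 1 ps) (suc l)
  add {Q} {ps = ps} s Q⊆Q′ Q′p ¬Qp M = record
    { positions = _ ∷ positions M
    ; size      = cong suc (size M)
    ; rainbow   = All.zipWith
                    (λ (Qq , p∼q) → All.head p∼q , λ eq → ¬Qp (subst Q (sym eq) Qq))
                    (colors M , apart M) ∷ rainbow M
    ; colors    = Q′p ∷ All.map Q⊆Q′ (colors M)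
    ; apart     = apart-after ps s ∷ All.map (drop⁺ 1 ∘ All.tail) (apart M)
    }

  finish : ∀ {Q ps l} → Matching Q ps l → RainbowMatching l
  finish M = positions M , size M , rainbow M

  -- Greedy extension

  mutual

    -- Each edge taken uses up at most two new colours, its own and that of its successor. The last
    -- edge taken needs only its own, hence the `suc`.
    extend : ∀ j {F l} ps → Sorted ps → j * 2 ≤ suc (newColors F ps) →
             Matching (_∈ F) ps l → RainbowMatching (j + l)
    extend zero    ps       s j≤ M = finish M
    extend (suc j) []       s (s≤s ()) M
    extend (suc j) {F} {l} (p ∷ ps) s j≤ M with col p ∈ᶜ? F
    ... | yes _   = extend (suc j) ps (AllPairs.tail s) j≤ (skip M)
    ... | no  p∉F = subst RainbowMatching (+-suc j l)
                      (extendAfter j ps (AllPairs.tail s) (s≤s⁻¹ (s≤s⁻¹ j≤))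
                        (add s there (here refl) p∉F M))

    -- The state right after taking an edge: the head of `ps` is blocked and may waste one new
    -- colour.
    extendAfter : ∀ j {F l} ps → Sorted ps → j * 2 ≤ newColors F ps →
                  Matching (_∈ F) (drop 1 ps) l → RainbowMatching (j + l)
    extendAfter zero    ps       s j≤ M = finish M
    extendAfter (suc j) {F} (p ∷ ps) s j≤ M with col p ∈ᶜ? F
    ... | yes _ = extend (suc j) ps (AllPairs.tail s) (≤-trans j≤ (n≤1+n _)) M
    ... | no  _ = extend (suc j) ps (AllPairs.tail s) j≤ (weaken there M)

  -- Matchings that avoid a prescribed colour

  Avoiding : Fin r → List (Fin r) → Pred (Fin r) _
  Avoiding c F d = d ∈ F × d ≢ c

  -- A weak matching may contain the edge just before ps, hence blocks the first edge of ps.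
  Strong Weak : List (Fin r) → List (Fin n) → ℕ → Fin r → Set
  Strong F ps l c = Matching (Avoiding c F) ps l
  Weak   F ps l c = c ∈ F × Matching (Avoiding c F) (drop 1 ps) l

  State : List (Fin r) → List (Fin n) → ℕ → Set
  State F ps l = ∀ c → Strong F ps l c ⊎ Weak F ps l c

  -- This is why `Weak` records `c ∈ F`: before an edge of a new colour a matching that does not
  -- block it is always available.
  strong-new : ∀ {F ps l c} → ¬ c ∈ F → State F ps l → Strong F ps l c
  strong-new {c = c} c∉F S with S c
  ... | inj₁ M         = M
  ... | inj₂ (c∈F , _) = ⊥-elim (c∉F c∈F)

  -- The saving: the matching grows by an edge without spending a new colour.
  add-repeated : ∀ {F p ps l} → Sorted (p ∷ ps) → col p ∈ F →
                 Strong F (p ∷ ps) l (col p) → Matching (_∈ F) (drop 1 ps) (suc l)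
  add-repeated s p∈F = add s proj₁ p∈F (λ (_ , p≢p) → p≢p refl)

  -- A strong matching takes `p` and stays strong, except that avoiding the colour of `p` forces
  -- `q`. A weak one cannot take `p`, so it takes `q` and stays weak.
  add-pair : ∀ {F p q ps l} → Sorted (p ∷ q ∷ ps) → ¬ col p ∈ F → ¬ col q ∈ col p ∷ F →
             State F (p ∷ q ∷ ps) l → State (col q ∷ col p ∷ F) ps (suc l)
  add-pair {F} {p} {q} {ps} {l} s@(_ ∷ s′) p∉F q∉pF S c with c Fin.≟ col p
  ... | yes refl = inj₂ (there (here refl) ,
          add s′ (λ (d∈F , d≢p) → there (there d∈F) , d≢p) (here refl , q∉pF ∘ here)
            (q∉pF ∘ there ∘ proj₁) (skip (strong-new p∉F S)))
  ... | no c≢p with S c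
  ...   | inj₁ M = inj₁
          (add s (λ (d∈F , d≢c) → there (there d∈F) , d≢c) (there (here refl) , c≢p ∘ sym)
            (p∉F ∘ proj₁) M)
  ...   | inj₂ (c∈F , M) = inj₂ (there (there c∈F) ,
          add s′ (λ (d∈F , d≢c) → there (there d∈F) , d≢c)
            (here refl , λ q≡c → q∉pF (there (subst (_∈ F) (sym q≡c) c∈F)))
            (q∉pF ∘ there ∘ proj₁) M)

  -- scan₀ resumes after a repeated edge, scan₁ inside a run; the slack between
  -- their length bounds pays for the one repeated edge that may end the run.
  mutual

    scan₀ : ∀ i {F l} ps → Sorted ps → suc (i * 3) ≤ length ps → i * 2 ≤ newColors F ps →
            (∀ c → Strong F ps l c) → RainbowMatching (suc i + l)
    scan₀ i {F} {l} (p ∷ ps) s len new S with col p ∈ᶜ? F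
    ... | yes p∈F = subst RainbowMatching (+-suc i l)
                      (extendAfter i ps (AllPairs.tail s) new (add-repeated s p∈F (S (col p))))
    ... | no  p∉F = scanNew i p ps s (s≤s⁻¹ len) p∉F new (inj₁ ∘ S)

    scan₁ : ∀ i {F l} ps → Sorted ps → 2 + i * 3 ≤ length ps → i * 2 ≤ newColors F ps →
            State F ps l → RainbowMatching (suc i + l)
    scan₁ i {F} {l} (p ∷ ps) s len new S with col p ∈ᶜ? F
    ... | no  p∉F = scanNew i p ps s (≤-trans (n≤1+n _) (s≤s⁻¹ len)) p∉F new S
    ... | yes p∈F with S (col p)
    ...   | inj₁ M = subst RainbowMatching (+-suc i l)
                       (extendAfter i ps (AllPairs.tail s) new (add-repeated s p∈F M))
    -- Nothing is saved, but the edge given up is the one that weak matchings block, so past it all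
    -- matchings are strong.
    ...   | inj₂ _ = scan₀ i ps (AllPairs.tail s) (s≤s⁻¹ len) new λ c → case S c of λ where
                       (inj₁ M)       → skip M
                       (inj₂ (_ , M)) → M

    scanNew : ∀ i {F l} p ps → Sorted (p ∷ ps) → i * 3 ≤ length ps → ¬ col p ∈ F →
              i * 2 ≤ suc (newColors (col p ∷ F) ps) →
              State F (p ∷ ps) l → RainbowMatching (suc i + l)
    scanNew zero {F} {l} p ps s len p∉F new S =
      finish (add {Q′ = _∈ col p ∷ F} s (there ∘ proj₁) (here refl) (p∉F ∘ proj₁) (strong-new p∉F S))
    scanNew (suc i) {F} {l} p (q ∷ ps) s@(_ ∷ s′) len p∉F new S with col q ∈ᶜ? (col p ∷ F)
    -- Taking `p` blocks only `q`, which has no new colour; this saves a colour and the greedy count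
    -- suffices.
    ... | yes _   = subst RainbowMatching (cong suc (+-suc i l))
                      (extend (suc i) ps (AllPairs.tail s′) new
                        (add {Q′ = _∈ col p ∷ F} s (there ∘ proj₁) (here refl) (p∉F ∘ proj₁)
                          (strong-new p∉F S)))
    ... | no  q∉pF = subst RainbowMatching (cong suc (+-suc i l))
                      (scan₁ i ps (AllPairs.tail s′) (s≤s⁻¹ len)
                        (s≤s⁻¹ (s≤s⁻¹ new)) (add-pair s p∉F q∉pF S))

  -- Counting colours and the upper bounds

  newColors-covers : ∀ F ps → (∀ c → c ∈ F ⊎ c ∈ map col ps) → r ≤ length F + newColors F ps
  newColors-covers F [] cover =
    subst (r ≤_) (sym (+-identityʳ (length F)))
      -- At the end `F` contains all `r` colours, and a colour is determined by its index in `F`.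
      (injective⇒≤ {f = λ c → Any.index (mem c)} (λ {c} {d} → index-injective (setoid _) (mem c) (mem d)))
    where
    mem : ∀ c → c ∈ F
    mem c with inj₁ c∈F ← cover c = c∈F
  newColors-covers F (p ∷ ps) cover with col p ∈ᶜ? F
  ... | yes p∈F = newColors-covers F ps λ c → case cover c of λ where
          (inj₁ c∈F)         → inj₁ c∈F
          (inj₂ (here refl)) → inj₁ p∈F
          (inj₂ (there c∈))  → inj₂ c∈
  ... | no _ = subst (r ≤_) (sym (+-suc (length F) _)) (newColors-covers (col p ∷ F) ps
          λ c → case cover c of λ where
          (inj₁ c∈F)         → inj₁ (there c∈F)
          (inj₂ (here refl)) → inj₁ (here refl)
          (inj₂ (there c∈))  → inj₂ c∈)

  emptyMatching : ∀ {Q ps} → Matching Q ps 0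
  emptyMatching = record { positions = [] ; size = refl ; rainbow = [] ; colors = [] ; apart = [] }

  sorted-allFin : Sorted (allFin n)
  sorted-allFin = tabulate⁺-< id

  module _ (surj : StrictlySurjective _≡_ col) where

    r≤newColors : r ≤ newColors [] (allFin n)
    r≤newColors = newColors-covers [] (allFin n) λ c →
      inj₂ (subst (_∈ map col (allFin n)) (proj₂ (surj c)) (∈-map⁺ col (∈-allFin (proj₁ (surj c)))))

    many-colors⇒rainbow : ∀ m → m * 2 ≤ suc r → RainbowMatching m
    many-colors⇒rainbow m m*2≤ = subst RainbowMatching (+-identityʳ m)
      (extend m (allFin n) sorted-allFin (≤-trans m*2≤ (s≤s r≤newColors)) emptyMatching)

    long-path⇒rainbow : ∀ i → i * 3 < n → i * 2 ≤ r → RainbowMatching (suc i)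
    long-path⇒rainbow i i*3<n i*2≤r = subst RainbowMatching (+-identityʳ (suc i))
      (scan₀ i (allFin n) sorted-allFin (subst (i * 3 <_) (sym (length-tabulate {n = n} id)) i*3<n)
        (≤-trans i*2≤r r≤newColors) (λ _ → emptyMatching))

-- Block colourings for the lower bounds

Near : ∀ {n} → Fin n → Fin n → Set
Near p q = toℕ p ≤ suc (toℕ q) × toℕ q ≤ suc (toℕ p)

-- By `same-block` a rainbow matching has at most one edge in each of the `b` blocks.
record BlockColoring (n k b : ℕ) : Set where
  field
    col        : Fin n → Fin k
    surjective : StrictlySurjective _≡_ col
    block      : Fin n → Fin b
    same-block : ∀ p q → block p ≡ block q → col p ≡ col q ⊎ Near p q

empty : BlockColoring 0 0 0
empty = record { col = λ () ; surjective = λ () ; block = λ () ; same-block = λ () }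

monochrome : ∀ n → BlockColoring (suc n) 1 1
monochrome n = record
  { col = λ _ → zero ; surjective = λ { zero → zero , refl } ; block = λ _ → zero
  ; same-block = λ _ _ _ → inj₁ refl }

near-suc : ∀ {n} {p q : Fin n} → Near p q → Near (suc p) (suc q)
near-suc (a , b) = s≤s a , s≤s b

prepend-ab : ∀ {n k b} → BlockColoring n k b → BlockColoring (2 + n) (2 + k) (1 + b)
prepend-ab {n} {k} {b} B = record { col = c ; surjective = s ; block = β ; same-block = sb }
  where
  c : Fin (2 + n) → Fin (2 + k)
  c zero          = zero
  c (suc zero)    = suc zero
  c (suc (suc p)) = suc (suc (BlockColoring.col B p))
  s : StrictlySurjective _≡_ c
  s zero          = zero , refl
  s (suc zero)    = suc zero , refl
  s (suc (suc y)) with p , refl ← BlockColoring.surjective B y = suc (suc p) , refl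
  β : Fin (2 + n) → Fin (1 + b)
  β zero          = zero
  β (suc zero)    = zero
  β (suc (suc p)) = suc (BlockColoring.block B p)
  sb : ∀ p q → β p ≡ β q → c p ≡ c q ⊎ Near p q
  sb zero          zero          _  = inj₁ refl
  sb zero          (suc zero)    _  = inj₂ (z≤n , s≤s z≤n)
  sb (suc zero)    zero          _  = inj₂ (s≤s z≤n , z≤n)
  sb (suc zero)    (suc zero)    _  = inj₁ refl
  sb (suc (suc p)) (suc (suc q)) eq =
    Sum.map (cong (λ y → suc (suc y))) (near-suc ∘ near-suc) (BlockColoring.same-block B p q (Fin.suc-injective eq))

prepend-aba : ∀ {n k b} → BlockColoring n k b → BlockColoring (3 + n) (2 + k) (1 + b)
prepend-aba {n} {k} {b} B = record { col = c ; surjective = s ; block = β ; same-block = sb }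
  where
  c : Fin (3 + n) → Fin (2 + k)
  c zero                = zero
  c (suc zero)          = suc zero
  c (suc (suc zero))    = zero
  c (suc (suc (suc p))) = suc (suc (BlockColoring.col B p))
  s : StrictlySurjective _≡_ c
  s zero          = zero , refl
  s (suc zero)    = suc zero , refl
  s (suc (suc y)) with p , refl ← BlockColoring.surjective B y = suc (suc (suc p)) , refl
  β : Fin (3 + n) → Fin (1 + b)
  β zero                = zero
  β (suc zero)          = zero
  β (suc (suc zero))    = zero
  β (suc (suc (suc p))) = suc (BlockColoring.block B p)
  sb : ∀ p q → β p ≡ β q → c p ≡ c q ⊎ Near p q
  sb zero                zero                _  = inj₁ refl
  sb zero                (suc zero)          _  = inj₂ (z≤n , s≤s z≤n)
  -- The outer edges of a block a b a are disjoint, but both have colour a.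
  sb zero                (suc (suc zero))    _  = inj₁ refl
  sb (suc zero)          zero                _  = inj₂ (s≤s z≤n , z≤n)
  sb (suc zero)          (suc zero)          _  = inj₁ refl
  sb (suc zero)          (suc (suc zero))    _  = inj₂ (s≤s z≤n , s≤s (s≤s z≤n))
  sb (suc (suc zero))    zero                _  = inj₁ refl
  sb (suc (suc zero))    (suc zero)          _  = inj₂ (s≤s (s≤s z≤n) , s≤s z≤n)
  sb (suc (suc zero))    (suc (suc zero))    _  = inj₁ refl
  sb (suc (suc (suc p))) (suc (suc (suc q))) eq =
    Sum.map (cong (λ y → suc (suc y))) (near-suc ∘ near-suc ∘ near-suc)
      (BlockColoring.same-block B p q (Fin.suc-injective eq))

-- Minimality of the rainbow number must exclude every smaller positive number of colours;
-- `pinch zero` identifies two colours at a time.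
merge : ∀ {n s k b} → suc s ≤′ k → BlockColoring n k b → BlockColoring n (suc s) b
merge ≤′-refl B = B
merge (≤′-step {suc k} s≤k) B = merge s≤k (record
  { col        = pinch zero ∘ BlockColoring.col B
  ; surjective = λ y → let (x , px≡y) = pinch-surjective zero y
                           (p , p≡x)  = BlockColoring.surjective B x
                       in p , trans (cong (pinch zero) p≡x) (px≡y refl)
  ; block      = BlockColoring.block B
  ; same-block = λ p q eq → Sum.map₁ (cong (pinch zero)) (BlockColoring.same-block B p q eq)
  })
merge (≤′-step {zero} s≤0) B with () ← ≤′⇒≤ s≤0

short-blocks : ∀ b n → b * 2 ≤ n → n ≤ b * 3 → BlockColoring n (b * 2) b
short-blocks zero    zero                _    _    = empty
short-blocks (suc b) (suc zero)          (s≤s ()) _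
short-blocks (suc b) (suc (suc n))       2b≤n n≤3b with n ≤? b * 3
... | yes n≤ = prepend-ab (short-blocks b n (s≤s⁻¹ (s≤s⁻¹ 2b≤n)) n≤)
short-blocks (suc b) (suc (suc zero))    2b≤n n≤3b | no n≰ = ⊥-elim (n≰ z≤n)
short-blocks (suc b) (suc (suc (suc n))) 2b≤n n≤3b | no n≰ =
  prepend-aba (short-blocks b n
    -- A block of three is used only when a block of two would leave more than `b * 3` edges, so at
    -- least `b * 3`, hence `b * 2`, remain.
    (≤-trans (*-monoʳ-≤ b (s≤s (s≤s (z≤n {1})))) (s≤s⁻¹ (≰⇒> n≰)))
    (s≤s⁻¹ (s≤s⁻¹ (s≤s⁻¹ n≤3b))))

long-blocks : ∀ b n → b * 2 < n → BlockColoring n (suc (b * 2)) (suc b)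
long-blocks zero    (suc n)       _    = monochrome n
long-blocks (suc b) (suc zero)    (s≤s ())
long-blocks (suc b) (suc (suc n)) 2b<n = prepend-ab (long-blocks b n (s≤s⁻¹ (s≤s⁻¹ 2b<n)))

-- Subgraphs built from the endpoints of a matching

anyBool? : {Q : Bool → Set} → (∀ a → Dec (Q a)) → Dec (∃ Q)
anyBool? Q? = map′ (λ { (inj₁ q) → false , q ; (inj₂ q) → true , q })
                   (λ { (false , q) → inj₁ q ; (true , q) → inj₂ q })
                   (Q? false ⊎-dec Q? true)

xor⇒not : ∀ a b → T (a xor b) → b ≡ not a
xor⇒not false true  _ = refl
xor⇒not true  false _ = refl

xor-not : ∀ a → T (a xor not a)
xor-not false = _
xor-not true  = _

K₂-edge⇒ : ∀ {m} {i j : Fin m} {a b} → Adj (m K₂) (i , a) (j , b) → i ≡ j × b ≡ not a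
K₂-edge⇒ {i = i} {j} {a} {b} t with i≡j , a⊕b ← Equivalence.to (T-∧ {⌊ i Fin.≟ j ⌋}) t =
  toWitness {a? = i Fin.≟ j} i≡j , xor⇒not a b a⊕b

K₂-edge : ∀ {m} (i : Fin m) a → Adj (m K₂) (i , a) (i , not a)
K₂-edge i a = Equivalence.from T-∧ (fromWitness {a? = i Fin.≟ i} refl , xor-not a)

module _ {V : Set} (_≟_ : DecidableEquality V) (G : SimpleGraph V) {m : ℕ}
         (end : Fin m × Bool → V)
         (end-injective : ∀ {x y} → end x ≡ end y → x ≡ y)
         (joined : ∀ i a → Adj G (end (i , a)) (end (i , not a))) where

  private
    IsVert : V → Set
    IsVert v = Σ[ i ∈ Fin m ] Σ[ a ∈ Bool ] v ≡ end (i , a)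

    isVert? : ∀ v → Dec (IsVert v)
    isVert? v = any? λ i → anyBool? λ a → v ≟ end (i , a)

    IsEdge : V → V → Set
    IsEdge u v = Σ[ i ∈ Fin m ] Σ[ a ∈ Bool ] (u ≡ end (i , a) × v ≡ end (i , not a))

    isEdge? : ∀ u v → Dec (IsEdge u v)
    isEdge? u v = any? λ i → anyBool? λ a → (u ≟ end (i , a)) ×-dec (v ≟ end (i , not a))

    isEdge-sym : ∀ {u v} → IsEdge u v → IsEdge v u
    isEdge-sym (i , a , refl , refl) = i , not a , refl , cong (λ b → end (i , b)) (sym (not-involutive a))

  -- The Boolean vertex and edge predicates come from a finite search over `Fin m` and `Bool`.
  matching : Subgraph G
  matching = record
    { vert      = λ v → ⌊ isVert? v ⌋
    ; edge      = λ u v → ⌊ isEdge? u v ⌋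
    ; edge-sym  = λ u v → fromWitness {a? = isEdge? v u} ∘ isEdge-sym ∘ toWitness {a? = isEdge? u v}
    ; edge⇒adj  = λ u v t → edge⇒adj (toWitness {a? = isEdge? u v} t)
    ; edge⇒vert = λ u v t → fromWitness {a? = isVert? u} (edge⇒vert (toWitness {a? = isEdge? u v} t))
    }
    where
    edge⇒adj : ∀ {u v} → IsEdge u v → Adj G u v
    edge⇒adj (i , a , refl , refl) = joined i a
    edge⇒vert : ∀ {u v} → IsEdge u v → IsVert u
    edge⇒vert (i , a , refl , _) = i , a , refl

  private
    open Subgraph matching using (Vertex; inclusion)

    vertex≡ : ∀ {x y : Vertex} → proj₁ x ≡ proj₁ y → x ≡ y
    vertex≡ {_ , s} {_ , t} refl = cong (_ ,_) (T-irrelevant s t)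

    index : Vertex → Fin m × Bool
    index (v , t) with i , a , _ ← toWitness {a? = isVert? v} t = i , a

    end-index : ∀ x → end (index x) ≡ proj₁ x
    end-index (v , t) = sym (proj₂ (proj₂ (toWitness {a? = isVert? v} t)))

    vertex : Fin m × Bool → Vertex
    vertex x@(i , a) = end x , fromWitness {a? = isVert? (end x)} (i , a , refl)

  matching≅ : Subgraph.graph matching ≅ (m K₂)
  matching≅ = record
    { bijection = mk↔ₛ′ index vertex (λ x → end-injective (end-index (vertex x)))
                                     (λ x → vertex≡ (end-index x))
    ; adj⇔ = λ u v → mk⇔ (to u v) (from u v)
    }
    where
    to : ∀ u v → Adj (Subgraph.graph matching) u v → Adj (m K₂) (index u) (index v)
    to u v t with i , a , u≡ , v≡ ← toWitness {a? = isEdge? (proj₁ u) (proj₁ v)} t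
      = subst₂ (Adj (m K₂)) (end-injective (sym (trans (end-index u) u≡)))
                            (end-injective (sym (trans (end-index v) v≡))) (K₂-edge i a)
    from : ∀ u v → Adj (m K₂) (index u) (index v) → Adj (Subgraph.graph matching) u v
    from u v t with i≡j , b≡ ← K₂-edge⇒ {i = proj₁ (index u)} {a = proj₂ (index u)} t
      = fromWitness {a? = isEdge? (proj₁ u) (proj₁ v)}
          ( proj₁ (index u) , proj₂ (index u) , sym (end-index u)
          , trans (sym (end-index v)) (cong end (cong₂ _,_ (sym i≡j) b≡)))

  private
    joined∼ : ∀ i a {u v t} → u ≡ end (i , a) → v ≡ end (i , not a) →
              _∼_ {G = G} (_ , _ , joined i false) (u , v , t)
    joined∼ i false refl refl = inj₁ (refl , refl)
    joined∼ i true  refl refl = inj₂ (refl , refl)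

    same-edge : ∀ {i} a b {u v x y} → u ≡ end (i , a) → v ≡ end (i , not a) →
                x ≡ end (i , b) → y ≡ end (i , not b) → (u ≡ x × v ≡ y) ⊎ (u ≡ y × v ≡ x)
    same-edge false false refl refl refl refl = inj₁ (refl , refl)
    same-edge false true  refl refl refl refl = inj₂ (refl , refl)
    same-edge true  false refl refl refl refl = inj₂ (refl , refl)
    same-edge true  true  refl refl refl refl = inj₁ (refl , refl)

  matching-rainbow : ∀ {r} (c : EdgeColoring G r) →
    (∀ i j → color c (_ , _ , joined i false) ≡ color c (_ , _ , joined j false) → i ≡ j) →
    Rainbow c matching
  matching-rainbow c inj e f = same-color (inclusion e) (inclusion f)
    (toWitness {a? = isEdge? _ _} (proj₂ (proj₂ e))) (toWitness {a? = isEdge? _ _} (proj₂ (proj₂ f)))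
    where
    same-color : ∀ (e f : Edge G) → IsEdge (proj₁ e) (proj₁ (proj₂ e)) →
                 IsEdge (proj₁ f) (proj₁ (proj₂ f)) → color c e ≡ color c f → _∼_ {G = G} e f
    same-color e f (i , a , u≡ , v≡) (j , b , x≡ , y≡) eq
      -- Both edges are first turned to the orientation starting at `false`, where `inj` applies.
      with refl ← inj i j (trans (EdgeColoring.respects-∼ c _ e (joined∼ i a {t = proj₂ (proj₂ e)} u≡ v≡))
                    (trans eq (sym (EdgeColoring.respects-∼ c _ f
                      (joined∼ j b {t = proj₂ (proj₂ f)} x≡ y≡)))))
      = same-edge a b u≡ v≡ x≡ y≡

-- Edges of the path and their positions

path-adj : ∀ {n} {u v : Fin (suc n)} → suc (toℕ u) ≡ toℕ v ⊎ suc (toℕ v) ≡ toℕ u → Adj (P n) u v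
path-adj {u = u} {v} (inj₁ eq) = Equivalence.from (T-∨ {suc (toℕ u) ≡ᵇ toℕ v}) (inj₁ (≡⇒≡ᵇ _ _ eq))
path-adj {u = u} {v} (inj₂ eq) = Equivalence.from (T-∨ {suc (toℕ u) ≡ᵇ toℕ v}) (inj₂ (≡⇒≡ᵇ _ _ eq))

path-adj⁻¹ : ∀ {n} {u v : Fin (suc n)} → Adj (P n) u v → suc (toℕ u) ≡ toℕ v ⊎ suc (toℕ v) ≡ toℕ u
path-adj⁻¹ {u = u} {v} t with Equivalence.to (T-∨ {suc (toℕ u) ≡ᵇ toℕ v}) t
... | inj₁ t′ = inj₁ (≡ᵇ⇒≡ _ _ t′)
... | inj₂ t′ = inj₂ (≡ᵇ⇒≡ _ _ t′)

-- The left (`false`) and right (`true`) ends of the edge at position `p`.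
step : ∀ {n} → Fin n → Bool → Fin (suc n)
step p false = inject₁ p
step p true  = suc p

step-adj : ∀ {n} (p : Fin n) a → Adj (P n) (step p a) (step p (not a))
step-adj p false = path-adj (inj₁ (cong suc (toℕ-inject₁ p)))
step-adj p true  = path-adj (inj₂ (cong suc (toℕ-inject₁ p)))

edgeAt : ∀ {n} → Fin n → Edge (P n)
edgeAt p = step p false , step p true , step-adj p false

step-between : ∀ {n} (u v : Fin (suc n)) → suc (toℕ u) ≡ toℕ v →
               Σ[ p ∈ Fin n ] (step p false ≡ u × step p true ≡ v)
step-between u (suc p) eq = p , toℕ-injective (trans (toℕ-inject₁ p) (sym (suc-injective eq))) , refl

locate : ∀ {n} (e : Edge (P n)) → Σ[ p ∈ Fin n ] _∼_ {G = P n} (edgeAt p) e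
locate (u , v , t) with path-adj⁻¹ {u = u} {v} t
... | inj₁ u+1≡v = let (p , u≡ , v≡) = step-between u v u+1≡v in p , inj₁ (u≡ , v≡)
... | inj₂ v+1≡u = let (p , v≡ , u≡) = step-between v u v+1≡u in p , inj₂ (v≡ , u≡)

∼-sym : ∀ {V} (G : SimpleGraph V) (e f : Edge G) → _∼_ {G = G} e f → _∼_ {G = G} f e
∼-sym G _ _ (inj₁ (refl , refl)) = inj₁ (refl , refl)
∼-sym G _ _ (inj₂ (refl , refl)) = inj₂ (refl , refl)

∼-trans : ∀ {V} (G : SimpleGraph V) (e f g : Edge G) →
          _∼_ {G = G} e f → _∼_ {G = G} f g → _∼_ {G = G} e g
∼-trans G _ _ _ (inj₁ (refl , refl)) q                    = q
∼-trans G _ _ _ (inj₂ (refl , refl)) (inj₁ (refl , refl)) = inj₂ (refl , refl)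
∼-trans G _ _ _ (inj₂ (refl , refl)) (inj₂ (refl , refl)) = inj₁ (refl , refl)

edgeAt-injective : ∀ {n} {p q : Fin n} → _∼_ {G = P n} (edgeAt p) (edgeAt q) → p ≡ q
edgeAt-injective (inj₁ (_ , p≡q)) = Fin.suc-injective p≡q
-- Opposite orientations would give both p = q + 1 and p + 1 = q.
edgeAt-injective {p = p} {q} (inj₂ (p≡q+1 , p+1≡q)) = ⊥-elim (<-irrefl
  (trans (sym (toℕ-inject₁ p)) (cong toℕ p≡q+1))
  (s≤s (≤-trans (n≤1+n _) (≤-reflexive (trans (cong toℕ p+1≡q) (toℕ-inject₁ q))))))

colorAt : ∀ {n r} → EdgeColoring (P n) r → Fin n → Fin r
colorAt c = color c ∘ edgeAt

colorAt-surjective : ∀ {n r} (c : EdgeColoring (P n) r) → StrictlySurjective _≡_ (colorAt c)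
colorAt-surjective c y with e , refl ← EdgeColoring.surjective c y =
  proj₁ (locate e) , EdgeColoring.respects-∼ c _ _ (proj₂ (locate e))

step-apart : ∀ {n} {p q : Fin n} a b → Apart p q → step p a ≢ step q b
step-apart {p = p} {q} a b = λ where
    (inj₁ p≪q) eq → lt a b p≪q (cong toℕ eq)
    (inj₂ q≪p) eq → lt b a q≪p (cong toℕ (sym eq))
  where
  lt : ∀ {p q} a b → suc (toℕ p) < toℕ q → toℕ (step p a) ≢ toℕ (step q b)
  -- Ends of `p` are at most p + 1, ends of `q` at least q, and p + 1 < q.
  lt {p} {q} a b p≪q eq = <-irrefl eq (≤-trans (s≤s (hi a)) (≤-trans p≪q (lo b)))
    where
    hi : ∀ a → toℕ (step p a) ≤ suc (toℕ p)
    hi false = ≤-trans (≤-reflexive (toℕ-inject₁ p)) (n≤1+n _)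
    hi true  = ≤-reflexive refl
    lo : ∀ b → toℕ q ≤ toℕ (step q b)
    lo false = ≤-reflexive (sym (toℕ-inject₁ q))
    lo true  = n≤1+n _

allPairs-lookup : ∀ {A : Set} {R : A → A → Set} → Symmetric R → ∀ {xs} → AllPairs R xs →
                  ∀ i j → i ≢ j → R (lookup xs i) (lookup xs j)
allPairs-lookup R-sym (_ ∷ _)     zero    zero    i≢j = ⊥-elim (i≢j refl)
allPairs-lookup R-sym (x∼xs ∷ _)  zero    (suc j) _   = All.lookup x∼xs (∈-lookup j)
allPairs-lookup R-sym (x∼xs ∷ _)  (suc i) zero    _   = R-sym (All.lookup x∼xs (∈-lookup i))
allPairs-lookup R-sym (_ ∷ pairs) (suc i) (suc j) i≢j = allPairs-lookup R-sym pairs i j (i≢j ∘ cong suc)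

rainbow-subgraph : ∀ {n m r} (c : EdgeColoring (P n) r) → RainbowMatching (colorAt c) m →
                   Σ[ S ∈ Subgraph (P n) ] (Subgraph.graph S ≅ (m K₂) × Rainbow c S)
rainbow-subgraph {n} {m} c (ps , refl , pairs) =
  matching Fin._≟_ (P n) end end-injective joined ,
  matching≅ Fin._≟_ (P n) end end-injective joined ,
  matching-rainbow Fin._≟_ (P n) end end-injective joined c color-injective
  where
  end : Fin m × Bool → Fin (suc n)
  end (i , a) = step (lookup ps i) a
  joined : ∀ i a → Adj (P n) (end (i , a)) (end (i , not a))
  joined i a = step-adj (lookup ps i) a
  distinct : ∀ i j → i ≢ j → RainbowPair (colorAt c) (lookup ps i) (lookup ps j)
  distinct = allPairs-lookup (λ (ap , c≢) → swap ap , c≢ ∘ sym) pairs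
  end-injective : ∀ {x y} → end x ≡ end y → x ≡ y
  end-injective {i , a} {j , b} eq with i Fin.≟ j
  ... | no i≢j   = ⊥-elim (step-apart a b (proj₁ (distinct i j i≢j)) eq)
  ... | yes refl = cong (i ,_) (bool a b eq)
    where
    bool : ∀ a b → end (i , a) ≡ end (i , b) → a ≡ b
    bool false false _  = refl
    bool true  true  _  = refl
    bool false true  eq = ⊥-elim (<-irrefl (trans (sym (toℕ-inject₁ _)) (cong toℕ eq)) (n<1+n _))
    bool true  false eq = ⊥-elim (<-irrefl (trans (sym (toℕ-inject₁ _)) (cong toℕ (sym eq))) (n<1+n _))
  color-injective : ∀ i j → colorAt c (lookup ps i) ≡ colorAt c (lookup ps j) → i ≡ j
  color-injective i j eq with i Fin.≟ j
  ... | yes i≡j = i≡j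
  ... | no  i≢j = ⊥-elim (proj₂ (distinct i j i≢j) eq)

-- Lower bound from block colourings

blockEdgeColoring : ∀ {n k b} → BlockColoring n k b → EdgeColoring (P n) k
blockEdgeColoring {n} B = record
  { color      = λ e → col (proj₁ (locate e))
  ; respects-∼ = λ e f e∼f → cong col (locate-cong e f e∼f)
  ; surjective = λ y → let (p , eq) = surjective y in
      edgeAt p , trans (cong col (edgeAt-injective (proj₂ (locate (edgeAt p))))) eq
  }
  where
  open BlockColoring B
  at : Edge (P n) → Edge (P n)
  at e = edgeAt (proj₁ (locate e))
  locate-cong : ∀ e f → _∼_ {G = P n} e f → proj₁ (locate e) ≡ proj₁ (locate f)
  locate-cong e f e∼f = edgeAt-injective
    (∼-trans (P n) (at e) e (at f) (proj₂ (locate e))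
      (∼-trans (P n) e f (at f) e∼f (∼-sym (P n) (at f) f (proj₂ (locate f)))))

_∈ₑ_ : ∀ {V} {G : SimpleGraph V} → V → Edge G → Set
w ∈ₑ (u , v , _) = w ≡ u ⊎ w ≡ v

∈ₑ-resp-∼ : ∀ {V} {G : SimpleGraph V} {e f : Edge G} {w} →
            _∼_ {G = G} e f → _∈ₑ_ {G = G} w e → _∈ₑ_ {G = G} w f
∈ₑ-resp-∼ (inj₁ (refl , refl)) w∈e = w∈e
∈ₑ-resp-∼ (inj₂ (refl , refl)) w∈e = swap w∈e

step∈edgeAt : ∀ {n} (p : Fin n) a → _∈ₑ_ {G = P n} (step p a) (edgeAt p)
step∈edgeAt p false = inj₁ refl
step∈edgeAt p true  = inj₂ refl

near-meet : ∀ {n} (p q : Fin n) → Near p q → Σ[ a ∈ Bool ] Σ[ b ∈ Bool ] step p a ≡ step q b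
near-meet p q (p≤ , q≤) with <-cmp (toℕ p) (toℕ q)
... | tri< p<q _ _ = true , false , toℕ-injective (trans (≤-antisym p<q q≤) (sym (toℕ-inject₁ q)))
... | tri≈ _ p≡q _ = true , true , cong suc (toℕ-injective p≡q)
... | tri> _ _ q<p = false , true , toℕ-injective (trans (toℕ-inject₁ p) (≤-antisym p≤ q<p))

-- By pigeonhole two matching edges lie in one block. If they agree in colour, rainbowness makes
-- them the same edge; if they are near, they share a vertex. Either way two distinct matching edges
-- meet.
no-rainbow : ∀ {n k b m} (B : BlockColoring n k b) → b < m → ∀ S →
             Subgraph.graph S ≅ (m K₂) → ¬ Rainbow (blockEdgeColoring B) S
no-rainbow {n} {m = m} B b<m S iso rainbow = <⇒≢ i<j (disjoint i j shared)
  where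
  open BlockColoring B
  open Subgraph S using (Vertex; graph; inclusion)
  open _≅_ iso
  open Inverse bijection using (to; from; strictlyInverseˡ)

  pair : Fin m → Edge graph
  pair i = from (i , false) , from (i , true) ,
    Equivalence.from (adj⇔ _ _)
      (subst₂ (Adj (m K₂)) (sym (strictlyInverseˡ _)) (sym (strictlyInverseˡ _)) (K₂-edge i false))

  Meet : Fin m → Fin m → Set
  Meet i j = Σ[ w ∈ Fin (suc n) ]
    (_∈ₑ_ {G = P n} w (inclusion (pair i)) × _∈ₑ_ {G = P n} w (inclusion (pair j)))

  from-injective : ∀ x y → proj₁ (from x) ≡ proj₁ (from y) → x ≡ y
  from-injective x y eq =
    trans (sym (strictlyInverseˡ x)) (trans (cong to (vertex≡ (from x) (from y) eq)) (strictlyInverseˡ y))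
    where
    vertex≡ : ∀ (u v : Vertex) → proj₁ u ≡ proj₁ v → u ≡ v
    vertex≡ (_ , s) (_ , t) refl = cong (_ ,_) (T-irrelevant s t)

  owner : ∀ i {w} → _∈ₑ_ {G = P n} w (inclusion (pair i)) → Σ[ a ∈ Bool ] w ≡ proj₁ (from (i , a))
  owner i (inj₁ eq) = false , eq
  owner i (inj₂ eq) = true , eq

  disjoint : ∀ i j → Meet i j → i ≡ j
  disjoint i j (w , w∈i , w∈j) with a , eq ← owner i w∈i | b , eq′ ← owner j w∈j =
    cong proj₁ (from-injective (i , a) (j , b) (trans (sym eq) eq′))

  position : Fin m → Fin n
  position i = proj₁ (locate (inclusion (pair i)))

  collision : Σ[ i ∈ Fin m ] Σ[ j ∈ Fin m ] (toℕ i < toℕ j × block (position i) ≡ block (position j))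
  collision = pigeonhole b<m (block ∘ position)

  i = proj₁ collision
  j = proj₁ (proj₂ collision)
  i<j = proj₁ (proj₂ (proj₂ collision))

  located : ∀ i a → _∈ₑ_ {G = P n} (step (position i) a) (inclusion (pair i))
  located i a = ∈ₑ-resp-∼ {G = P n} {e = edgeAt (position i)} {f = inclusion (pair i)}
    (proj₂ (locate (inclusion (pair i)))) (step∈edgeAt (position i) a)

  shared : Meet i j
  shared with same-block (position i) (position j) (proj₂ (proj₂ (proj₂ collision)))
  ... | inj₁ same-color = _ , inj₁ refl ,
          ∈ₑ-resp-∼ {G = P n} {e = inclusion (pair i)} {f = inclusion (pair j)}
            (rainbow (pair i) (pair j) same-color) (inj₁ refl)
  ... | inj₂ near with a , b , eq ← near-meet (position i) (position j) near =
          _ , located i a , subst (λ w → _∈ₑ_ {G = P n} w (inclusion (pair j))) (sym eq) (located j b)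

-- Assembling the rainbow number

isRainbowNumber : ∀ {n k b} → BlockColoring n k b →
                  ((c : EdgeColoring (P n) (suc k)) → RainbowMatching (colorAt c) (suc b)) →
                  IsRainbowNumber (P n) (suc b K₂) (suc k)
isRainbowNumber {n} {k} {b} B found = record
  { positive = s≤s z≤n
  ; forces   = λ c → rainbow-subgraph c (found c)
  ; minimal  = minimal
  }
  where
  minimal : ∀ s → 1 ≤ s → ForcesRainbow (P n) (suc b K₂) s → suc k ≤ s
  minimal (suc s) _ forces = ≮⇒≥ λ s<k →
    let B′          = merge (≤⇒≤′ (s≤s⁻¹ s<k)) B
        S , iso , R = forces (blockEdgeColoring B′)
    in no-rainbow B′ (n<1+n b) S iso R

≤⌊/2⌋⇒*2≤ : ∀ m n → m ≤ ⌊ n /2⌋ → m * 2 ≤ n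
≤⌊/2⌋⇒*2≤ zero    n             _  = z≤n
≤⌊/2⌋⇒*2≤ (suc m) (suc (suc n)) m≤ = s≤s (s≤s (≤⌊/2⌋⇒*2≤ m n (s≤s⁻¹ m≤)))

theorem3p5 : (n m : ℕ) → 3 ≤ n → 2 ≤ m → m ≤ ⌈ n /2⌉ →
    (n ≤ 3 * m ∸ 3 → IsRainbowNumber (P n) (m K₂) (2 * m ∸ 1)) ×
    (n > 3 * m ∸ 3 → IsRainbowNumber (P n) (m K₂) (2 * m ∸ 2))
theorem3p5 n (suc zero) _ (s≤s ()) _
theorem3p5 n m@(suc b@(suc i)) _ _ m≤ = short , long
  where
  2b≤n : b * 2 ≤ n
  -- `⌈ n /2⌉` unfolds to `⌊ suc n /2⌋`, giving 2b + 2 ≤ n + 1; one unit is given away.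
  2b≤n = s≤s⁻¹ (≤-trans (n≤1+n _) (≤⌊/2⌋⇒*2≤ m (suc n) m≤))

  3m-3 : 3 * m ∸ 3 ≡ b * 3
  3m-3 = cong (_∸ 3) (*-comm 3 m)

  short : n ≤ 3 * m ∸ 3 → IsRainbowNumber (P n) (m K₂) (2 * m ∸ 1)
  short n≤ = subst (IsRainbowNumber (P n) (m K₂)) (cong (_∸ 1) (*-comm m 2))
    (isRainbowNumber (short-blocks b n 2b≤n (subst (n ≤_) 3m-3 n≤)) λ c →
      many-colors⇒rainbow (colorAt c) (colorAt-surjective c) m ≤-refl)

  long : n > 3 * m ∸ 3 → IsRainbowNumber (P n) (m K₂) (2 * m ∸ 2)
  long n> = subst (IsRainbowNumber (P n) (m K₂)) (cong (_∸ 2) (*-comm m 2))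
    -- Here i = m - 2, so there are 2m - 3 colours on m - 1 blocks.
    (isRainbowNumber (long-blocks i n (≤-trans (n≤1+n _) 2b≤n)) λ c →
      long-path⇒rainbow (colorAt c) (colorAt-surjective c) b (subst (_< n) 3m-3 n>) ≤-refl)
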